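{- The age of $\mathcal P(3)^*$ has the expansion property relative to the age of $\mathcal P(3)$.
   Context: Let $\mathcal P=(P,\prec)$ be the generic partial order. A subset $D\subseteq P$ is dense if for all $x\prec z$ there is $y\in D$ with $x\prec y\prec z$. Partition $P$ into three dense subsets $P_0,P_1,P_2$. For a set $X$ of ordered pairs let $T^X_{ -1}=\{(x,y):(x,y)\in X\}$, $T^X_1=\{(x,y):(y,x)\in X\}$ and $T^X_0$ the remaining pairs of distinct elements. $\mathcal P(3)$ is the directed graph on $P$ with edge set $E$ such that for $x\in P_i$, $y\in P_j$, $k\in\{ -1,0,1\}$: $(x,y)\in T^{\prec}_k$ iff $(x,y)\in T^E_{k'}$, where $k'\in\{ -1,0,1\}$, $k'\equiv k+(j-i)\pmod 3$. $\mathcal P(3)^*$ expands $\mathcal P(3)$ by unary predicates $R_i=P_i$ and a linear order $<$ extending $\prec$, chosen so that $\mathcal P(3)^*$ is a Fraïssé (homogeneous) structure. If $\mathcal K^*$ is a class of expansions of members of $\mathcal K$, it has the expansion property relative to $\mathcal K$ if for every $\mathbf A\in\mathcal K$ there is $\mathbf B\in\mathcal K$ such that every expansion of $\mathbf A$ in $\mathcal K^*$ embeds in every expansion of $\mathbf B$ in $\mathcal K^*$. The age of a structure is the class of finite structures embeddable in it. -}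

module Defs where

open import Data.Nat using (ℕ; _+_; _∸_; _%_)
open import Data.Fin using (Fin; toℕ)
open import Data.Bool using (Bool; true)
open import Data.Product using (Σ; _×_; ∃)
open import Data.Sum using (_⊎_)
open import Relation.Nullary using (¬_)
open import Relation.Binary.PropositionalEquality using (_≡_; _≢_)
open import Relation.Binary.Structures using (IsStrictPartialOrder)
open import Function.Bundles using (_⇔_; _↔_; Inverse)
open import Function.Definitions using (Injective; Surjective)

IsFinPoset : ∀ {n} → (Fin n → Fin n → Bool) → Set
IsFinPoset R = IsStrictPartialOrder _≡_ (λ i j → R i j ≡ true)

-- The generic partial order: the Fraïssé limit of the class of finite
-- partial orders, i.e. a countable strict partial order which is
-- universal for finite partial orders and (ultra)homogeneous.

record IsGenericPO (P : Set) (_≺_ : P → P → Set) : Set₁ where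
  field
    isSPO       : IsStrictPartialOrder _≡_ _≺_
    countable   : Σ (ℕ → P) (Surjective _≡_ _≡_)
    universal   : ∀ n (R : Fin n → Fin n → Bool) → IsFinPoset R →
                  Σ (Fin n → P) λ f → Injective _≡_ _≡_ f ×
                    (∀ i j → (R i j ≡ true) ⇔ (f i ≺ f j))
    homogeneous : ∀ n (a b : Fin n → P) →
                  Injective _≡_ _≡_ a → Injective _≡_ _≡_ b →
                  (∀ i j → (a i ≺ a j) ⇔ (b i ≺ b j)) →
                  Σ (P ↔ P) λ σ →
                    (∀ x y → (x ≺ y) ⇔ (Inverse.to σ x ≺ Inverse.to σ y)) ×
                    (∀ i → Inverse.to σ (a i) ≡ b i)

DenseColour : {P : Set} → (P → P → Set) → (P → Fin 3) → Fin 3 → Set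
DenseColour {P} _≺_ col c =
  ∀ x z → x ≺ z → ∃ λ y → col y ≡ c × x ≺ y × y ≺ z

-- The edge relation of P(3).  Let x ∈ P_i, y ∈ P_j, d = (j - i) mod 3.
-- k = -1 if x ≺ y, k = 1 if y ≺ x, k = 0 otherwise (x ≠ y).
-- (x,y) ∈ E  iff  k + d ≡ -1 (mod 3), i.e.
--   x ≺ y and d = 0, or y ≺ x and d = 1, or x,y distinct incomparable and d = 2.

colDiff : Fin 3 → Fin 3 → ℕ
colDiff i j = (3 + toℕ j ∸ toℕ i) % 3

Edge : {P : Set} → (P → P → Set) → (P → Fin 3) → P → P → Set
Edge _≺_ col x y =
  (x ≺ y × colDiff (col x) (col y) ≡ 0) ⊎
  (y ≺ x × colDiff (col x) (col y) ≡ 1) ⊎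
  (x ≢ y × ¬ (x ≺ y) × ¬ (y ≺ x) × colDiff (col x) (col y) ≡ 2)

-- P(3)^* : the expansion of P(3) by R_i = P_i (colours) and a linear
-- order < extending ≺, such that the expansion is Fraïssé
-- (countable — inherited from P — and homogeneous).

record IsLinearExt {P : Set} (_≺_ _<_ : P → P → Set) : Set where
  field
    isSPO    : IsStrictPartialOrder _≡_ _<_
    connex   : ∀ x y → x ≢ y → (x < y) ⊎ (y < x)
    extends  : ∀ x y → x ≺ y → x < y

IsHomogeneousP3* : {P : Set} → (P → P → Set) → (P → Fin 3) → (P → P → Set) → Set
IsHomogeneousP3* {P} _≺_ col _<_ =
  ∀ n (a b : Fin n → P) →
    Injective _≡_ _≡_ a → Injective _≡_ _≡_ b →
    (∀ i j → Edge _≺_ col (a i) (a j) ⇔ Edge _≺_ col (b i) (b j)) →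
    (∀ i → col (a i) ≡ col (b i)) →
    (∀ i j → (a i < a j) ⇔ (b i < b j)) →
    Σ (P ↔ P) λ σ →
      (∀ x y → Edge _≺_ col x y ⇔ Edge _≺_ col (Inverse.to σ x) (Inverse.to σ y)) ×
      (∀ x → col x ≡ col (Inverse.to σ x)) ×
      (∀ x y → (x < y) ⇔ (Inverse.to σ x < Inverse.to σ y)) ×
      (∀ i → Inverse.to σ (a i) ≡ b i)

-- Ages.  A finite digraph is (n , E) with E : Fin n → Fin n → Bool.
-- An expansion of it is (c , L) : colours c : Fin n → Fin 3 (R_i = c⁻¹ i)
-- and L : Fin n → Fin n → Bool interpreting <.

InAgeP3 : {P : Set} → (P → P → Set) → (P → Fin 3) →
          ∀ n → (Fin n → Fin n → Bool) → Set
InAgeP3 {P} _≺_ col n E =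
  Σ (Fin n → P) λ f → Injective _≡_ _≡_ f ×
    (∀ i j → (E i j ≡ true) ⇔ Edge _≺_ col (f i) (f j))

InAgeP3* : {P : Set} → (P → P → Set) → (P → Fin 3) → (P → P → Set) →
           ∀ n → (Fin n → Fin n → Bool) → (Fin n → Fin 3) →
           (Fin n → Fin n → Bool) → Set
InAgeP3* {P} _≺_ col _<_ n E c L =
  Σ (Fin n → P) λ f → Injective _≡_ _≡_ f ×
    (∀ i j → (E i j ≡ true) ⇔ Edge _≺_ col (f i) (f j)) ×
    (∀ i → c i ≡ col (f i)) ×
    (∀ i j → (L i j ≡ true) ⇔ (f i < f j))

Embeds* : ∀ n → (Fin n → Fin n → Bool) → (Fin n → Fin 3) → (Fin n → Fin n → Bool) →
          ∀ m → (Fin m → Fin m → Bool) → (Fin m → Fin 3) → (Fin m → Fin m → Bool) → Set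
Embeds* n E c L m E' c' L' =
  Σ (Fin n → Fin m) λ g → Injective _≡_ _≡_ g ×
    (∀ i j → E i j ≡ E' (g i) (g j)) ×
    (∀ i → c i ≡ c' (g i)) ×
    (∀ i j → L i j ≡ L' (g i) (g j))

{-# OPTIONS --safe #-}
module Submission where

-- An expansion of a digraph amounts to a choice of colours, hence of a partial
-- order, together with a linear extension; two choices of colours differ by a
-- switch s with values in ℤ/3.
--
-- Linear extensions: if two incomparable copies of a poset C both contain the
-- ordered poset A, then a new point above all of the copy that ends later comes
-- after the copy that ends earlier, while its down-set in the latter is free.
-- Adding points above all subsets, n times, thus forces every ordered coloured
-- poset on n points into every linear extension.
--
-- Colours: if i, j are incomparable with s j = s i + 1, and x lies above both with
-- s x = s i, then the switched relation has the cycle j ≺ i ≺ x ≺ j.  So a pair of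
-- incomparable points on which s differs removes a value of s from everything
-- above it, and in a tower of three layers s is constant on a copy of C.

open import Defs
open import Data.Bool using (Bool; true; false; not; if_then_else_)
import Data.Bool.Properties as Bool
open import Data.Empty using (⊥)
open import Data.Fin using (Fin; toℕ; finToFun; funToFin)
open import Data.Fin.Patterns using (0F; 1F; 2F)
import Data.Fin.Properties as Fin
open import Data.Fin.Subset using (Subset; _∈_; ∣_∣)
open import Data.Fin.Subset.Properties using (p⊂q⇒∣p∣<∣q∣; ∣p∣≤n)
open import Data.Nat as ℕ using (ℕ; zero; suc; _+_; _*_; _^_; _∸_)
open import Data.Nat.DivMod using (_mod_)
import Data.Nat.Properties as ℕ
open import Data.Product using (Σ; ∃; _×_; _,_; proj₁; proj₂)
open import Data.Product.Function.NonDependent.Propositional using (_×-↔_)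
open import Data.Product.Relation.Binary.Lex.Strict using (×-Lex; ×-transitive; ×-decidable)
open import Data.Sum as Sum using (_⊎_; inj₁; inj₂; [_,_])
open import Data.Sum.Function.Propositional using (_⊎-↔_)
open import Data.Unit using (⊤; tt)
open import Data.Vec using (tabulate)
open import Data.Vec.Properties using (lookup∘tabulate; lookup⇒[]=; []=⇒lookup)
open import Function using (_∘_; _on_; id)
open import Function.Bundles using (_⇔_; _↔_; mk⇔; Injection; Inverse; Equivalence)
open import Function.Definitions using (Injective)
open import Function.Properties.Equivalence using () renaming (sym to ⇔-sym; trans to ⇔-trans)
open import Function.Properties.Inverse using (↔-trans; ↔-sym; ↔-refl; ↔⇒↣)
open import Relation.Binary.Definitions using (Decidable; DecidableEquality; Transitive; tri<; tri≈; tri>)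
open import Relation.Binary.PropositionalEquality hiding ([_])
open import Relation.Binary.Structures using (IsStrictPartialOrder)
open import Relation.Nullary using (¬_; Dec; yes; no; does; contradiction)
open import Relation.Nullary.Decidable as Dec using (map′; via-injection; toWitness; _×-dec_; _⊎-dec_; _→-dec_; ¬?; decidable-stable)
open import Relation.Nullary.Negation using (¬¬-map)
import Relation.Unary as Unary

-- Strict orders and pullbacks of linear extensions.

isSPO-≡ : ∀ {A : Set} {_≺_ : A → A → Set} → (∀ {x} → ¬ (x ≺ x)) → Transitive _≺_ →
          IsStrictPartialOrder _≡_ _≺_
isSPO-≡ irrefl trans = record
  { isEquivalence = isEquivalence
  ; irrefl = λ { refl → irrefl }
  ; trans = trans
  ; <-resp-≈ = (λ { refl → id }) , (λ { refl → id })
  }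

-- Monotonicity is asked only into `_<_`: in `C-linear` the partial order between images is known
-- only up to double negation, whereas `_<_` is decidable there.
linearExt-pullback : ∀ {A B : Set} {_≺_ : A → A → Set} {_≺′_ _<_ : B → B → Set} →
  IsLinearExt _≺′_ _<_ → (h : A → B) → Injective _≡_ _≡_ h →
  (∀ x y → x ≺ y → h x < h y) → IsLinearExt _≺_ (_<_ on h)
linearExt-pullback lin h h-inj mono = record
  { isSPO = isSPO-≡ (irrefl refl) <-trans
  ; connex = λ x y x≢y → connex (h x) (h y) (x≢y ∘ h-inj)
  ; extends = mono
  }
  where
  open IsLinearExt lin
  open IsStrictPartialOrder isSPO renaming (trans to <-trans)

-- Finite coloured posets and constructions on them.

record ColouredPoset : Set₁ where
  infix 4 _≺_ _≺?_ _≟_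
  field
    Carrier : Set
    size    : ℕ
    enum    : Fin size ↔ Carrier
    _≺_     : Carrier → Carrier → Set
    _≺?_    : Decidable _≺_
    irrefl  : ∀ {x} → ¬ (x ≺ x)
    ≺-trans : Transitive _≺_
    colour  : Carrier → Fin 3

  point : Fin size → Carrier
  point = Inverse.to enum

  index : Carrier → Fin size
  index = Inverse.from enum

  point-index : ∀ x → point (index x) ≡ x
  point-index = Inverse.strictlyInverseˡ enum

  point-injective : Injective _≡_ _≡_ point
  point-injective = Injection.injective (↔⇒↣ enum)

  index-injective : Injective _≡_ _≡_ index
  index-injective = Injection.injective (↔⇒↣ (↔-sym enum))

  _≟_ : DecidableEquality Carrier
  _≟_ = via-injection (↔⇒↣ (↔-sym enum)) Fin._≟_

  any? : ∀ {Q : Carrier → Set} → Unary.Decidable Q → Dec (∃ Q)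
  any? {Q} Q? = map′ (λ { (i , q) → point i , q })
                     (λ { (x , q) → index x , subst Q (sym (point-index x)) q })
                     (Fin.any? (Q? ∘ point))

singleton : ColouredPoset
singleton = record
  { Carrier = ⊤
  ; size = 1
  ; enum = Fin.1↔⊤
  ; _≺_ = λ _ _ → ⊥
  ; _≺?_ = λ _ _ → no λ ()
  ; irrefl = λ ()
  ; ≺-trans = λ ()
  ; colour = λ _ → 0F
  }

-- Disjoint union of two copies. In `rich` the copies compete for the later position; in the tower
-- of layers one copy supplies a point incomparable to all of the other.
double : ColouredPoset → ColouredPoset
double X = record
  { Carrier = Bool × X.Carrier
  ; size = 2 * X.size
  ; enum = ↔-trans Fin.*↔× (Fin.2↔Bool ×-↔ X.enum)
  ; _≺_ = λ (a , x) (b , y) → a ≡ b × x X.≺ y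
  ; _≺?_ = λ (a , x) (b , y) → (a Bool.≟ b) ×-dec (x X.≺? y)
  ; irrefl = X.irrefl ∘ proj₂
  ; ≺-trans = λ (p , q) (p′ , q′) → trans p p′ , X.≺-trans q q′
  ; colour = X.colour ∘ proj₂
  }
  where module X = ColouredPoset X

chain : ℕ → ColouredPoset
chain h = record
  { Carrier = Fin h
  ; size = h
  ; enum = ↔-refl
  ; _≺_ = Data.Fin._<_
  ; _≺?_ = Fin._<?_
  ; irrefl = Fin.<-irrefl refl
  ; ≺-trans = Fin.<-trans
  -- Arbitrary: `lex` takes its colours from the second factor, and `universal-poset` ignores
  -- colours.
  ; colour = λ _ → 0F
  }

-- The first coordinate dominates: `lex (chain 3) Y` stacks three layers of `Y`, and
-- `lex X (chain 2)` replaces each point of `X` by a two-point chain.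
lex : ColouredPoset → ColouredPoset → ColouredPoset
lex X Y = record
  { Carrier = X.Carrier × Y.Carrier
  ; size = X.size * Y.size
  ; enum = ↔-trans Fin.*↔× (X.enum ×-↔ Y.enum)
  ; _≺_ = ×-Lex _≡_ X._≺_ Y._≺_
  ; _≺?_ = ×-decidable X._≟_ X._≺?_ Y._≺?_
  ; irrefl = [ X.irrefl , Y.irrefl ∘ proj₂ ]
  ; ≺-trans = ×-transitive {_<₂_ = Y._≺_} isEquivalence (resp₂ X._≺_) X.≺-trans Y.≺-trans
  ; colour = Y.colour ∘ proj₂
  }
  where
  module X = ColouredPoset X
  module Y = ColouredPoset Y

-- Adding points above all subsets.

module Upward (X : ColouredPoset) where
  open ColouredPoset X

  Code : Set
  Code = Fin (2 ^ size)

  _∋_ : Code → Carrier → Set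
  S ∋ x = finToFun {2} S (index x) ≡ 1F

  module _ {Q : Carrier → Set} (Q? : Unary.Decidable Q) where
    private
      bit : Fin size → Fin 2
      bit i = if does (Q? (point i)) then 1F else 0F

      bit-index : ∀ x → finToFun (funToFin bit) (index x) ≡ (if does (Q? x) then 1F else 0F)
      bit-index x = trans (Fin.finToFun-funToFin bit (index x))
                          (cong (λ y → if does (Q? y) then 1F else 0F) (point-index x))

    encode : Code
    encode = funToFin bit

    encode-complete : ∀ x → Q x → encode ∋ x
    encode-complete x q with Q? x | bit-index x
    ... | yes _ | eq = eq
    ... | no ¬q | _  = contradiction q ¬q

    encode-sound : ∀ x → encode ∋ x → Q x
    encode-sound x S∋x with Q? x | bit-index x
    ... | yes q | _  = q
    ... | no _  | eq with trans (sym S∋x) eq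
    ...   | ()

  _≼_ : Carrier → Carrier → Set
  x ≼ y = x ≡ y ⊎ x ≺ y

  Carrier↑ : Set
  Carrier↑ = Carrier ⊎ (Fin 3 × Code)

  -- (c , S) is a new point of colour c whose strict down-set is generated by S.
  _≺↑_ : Carrier↑ → Carrier↑ → Set
  inj₁ x ≺↑ inj₁ y       = x ≺ y
  inj₁ x ≺↑ inj₂ (_ , S) = ∃ λ y → S ∋ y × x ≼ y
  inj₂ _ ≺↑ _            = ⊥

  _≺↑?_ : Decidable _≺↑_
  inj₁ x ≺↑? inj₁ y       = x ≺? y
  inj₁ x ≺↑? inj₂ (_ , S) =
    any? λ y → (finToFun {2} S (index y) Fin.≟ 1F) ×-dec ((x ≟ y) ⊎-dec (x ≺? y))
  inj₂ _ ≺↑? _            = no λ ()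

  ≺↑-irrefl : ∀ {x} → ¬ (x ≺↑ x)
  ≺↑-irrefl {inj₁ x} = irrefl

  ≺↑-trans : Transitive _≺↑_
  ≺↑-trans {inj₁ _} {inj₁ _} {inj₁ _} x≺y y≺z = ≺-trans x≺y y≺z
  ≺↑-trans {inj₁ _} {inj₁ _} {inj₂ _} x≺y (g , S∋g , inj₁ refl) = g , S∋g , inj₂ x≺y
  ≺↑-trans {inj₁ _} {inj₁ _} {inj₂ _} x≺y (g , S∋g , inj₂ y≺g) = g , S∋g , inj₂ (≺-trans x≺y y≺g)

  upward : ColouredPoset
  upward = record
    { Carrier = Carrier↑
    ; size = size + 3 * 2 ^ size
    ; enum = ↔-trans Fin.+↔⊎ (enum ⊎-↔ Fin.*↔×)
    ; _≺_ = _≺↑_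
    ; _≺?_ = _≺↑?_
    ; irrefl = λ {x} → ≺↑-irrefl {x}
    ; ≺-trans = λ {x} {y} {z} → ≺↑-trans {x} {y} {z}
    ; colour = [ colour , proj₁ ]
    }

open Upward using (upward)

-- Each step doubles, to have two competing copies, and then adds candidates of every colour for the
-- point of the next rank.
rich : ℕ → ColouredPoset
rich zero    = singleton
rich (suc k) = upward (double (rich k))

-- Ordered coloured posets inside every linear extension.

-- The linear order is recorded by `rank`, so that induction can run over initial segments.
-- Irreflexivity of `_⊏_` follows from `⊏⇒rank<`.
record RankedPoset (n : ℕ) : Set₁ where
  infix 4 _⊏_ _⊏?_
  field
    _⊏_            : Fin n → Fin n → Set
    _⊏?_           : Decidable _⊏_
    ⊏-trans        : Transitive _⊏_
    rank           : Fin n → ℕ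
    rank-injective : Injective _≡_ _≡_ rank
    ⊏⇒rank<        : ∀ {i j} → i ⊏ j → rank i ℕ.< rank j
    hue            : Fin n → Fin 3

module _ {n : ℕ} (A : RankedPoset n) where
  open RankedPoset A

  -- Points of rank at least k are sent to junk values.
  record InitialEmbedding (k : ℕ) (X : ColouredPoset)
                          (_<_ : ColouredPoset.Carrier X → ColouredPoset.Carrier X → Set) : Set where
    open ColouredPoset X
    field
      embed    : Fin n → Carrier
      preserve : ∀ {i j} → rank i ℕ.< k → rank j ℕ.< k → i ⊏ j → embed i ≺ embed j
      reflect  : ∀ {i j} → rank i ℕ.< k → rank j ℕ.< k → embed i ≺ embed j → i ⊏ j
      ordered  : ∀ {i j} → rank i ℕ.< k → rank j ℕ.< k → rank i ℕ.< rank j → embed i < embed j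
      coloured : ∀ {i} → rank i ℕ.< k → colour (embed i) ≡ hue i

  -- The new point of rank k goes above a copy e′ that reaches beyond all of the
  -- copy e, which places it after e in the linear order without making it
  -- comparable to more of e than required.
  module Extend (X : ColouredPoset) (k : ℕ) (b : Bool)
    {_<_ : ColouredPoset.Carrier (upward (double X)) → ColouredPoset.Carrier (upward (double X)) → Set}
    (lin : IsLinearExt (ColouredPoset._≺_ (upward (double X))) _<_)
    (e  : InitialEmbedding k X (_<_ on λ x → inj₁ (b , x)))
    (e′ : InitialEmbedding k X (_<_ on λ x → inj₁ (not b , x)))
    (overtaken : ∀ i → rank i ℕ.< k → ∃ λ j → rank j ℕ.< k ×
      inj₁ (b , InitialEmbedding.embed e i) < inj₁ (not b , InitialEmbedding.embed e′ j)) where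

    private
      module X = ColouredPoset X
      module D = ColouredPoset (double X)
      module Y = ColouredPoset (upward (double X))
      module e = InitialEmbedding e
      module e′ = InitialEmbedding e′
      open Upward (double X) using (encode; encode-complete; encode-sound)
      open IsLinearExt lin
      open IsStrictPartialOrder isSPO using () renaming (trans to <-trans; irrefl to <-irrefl)

      -- The first clause yields the required down-set in copy `b`. The second puts all of `e′`
      -- below the new point; these comparabilities go unseen, as the old points used lie in copy
      -- `b`.
      Generator : Fin n → D.Carrier → Set
      Generator i x = (∃ λ j → rank j ℕ.< k × j ⊏ i × x ≡ (b , e.embed j))
                    ⊎ (∃ λ j → rank j ℕ.< k × x ≡ (not b , e′.embed j))

      Generator? : ∀ i → Unary.Decidable (Generator i)
      Generator? i x =
        Fin.any? (λ j → (rank j ℕ.<? k) ×-dec (j ⊏? i) ×-dec (x D.≟ (b , e.embed j)))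
        ⊎-dec Fin.any? (λ j → (rank j ℕ.<? k) ×-dec (x D.≟ (not b , e′.embed j)))

      old new : Fin n → Y.Carrier
      old i = inj₁ (b , e.embed i)
      new i = inj₂ (hue i , encode (Generator? i))

      choose : ∀ i → Dec (rank i ℕ.< k) → Y.Carrier
      choose i (yes _) = old i
      choose i (no _)  = new i

      e-injective : ∀ {i j} → rank i ℕ.< k → rank j ℕ.< k → e.embed i ≡ e.embed j → i ≡ j
      e-injective {i} {j} p q eq with ℕ.<-cmp (rank i) (rank j)
      ... | tri< r _ _ = contradiction (e.ordered p q r) (<-irrefl (cong (λ x → inj₁ (b , x)) eq))
      ... | tri≈ _ r _ = rank-injective r
      ... | tri> _ _ r = contradiction (e.ordered q p r) (<-irrefl (cong (λ x → inj₁ (b , x)) (sym eq)))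

      old≺new : ∀ {i j} → rank i ℕ.< k → i ⊏ j → old i Y.≺ new j
      old≺new {i} {j} p i⊏j =
        _ , encode-complete (Generator? j) _ (inj₁ (i , p , i⊏j , refl)) , inj₁ refl

      old≺new⁻ : ∀ {i j} → rank i ℕ.< k → old i Y.≺ new j → i ⊏ j
      old≺new⁻ {i} {j} p (g , S∋g , i≼g) with encode-sound (Generator? j) g S∋g | i≼g
      ... | inj₁ (l , q , l⊏j , refl) | inj₁ eq =
        subst (_⊏ j) (sym (e-injective p q (cong proj₂ eq))) l⊏j
      -- The down-set contains more than its generators; transitivity of `_⊏_` absorbs the
      -- difference.
      ... | inj₁ (l , q , l⊏j , refl) | inj₂ (_ , i≺l) = ⊏-trans (e.reflect p q i≺l) l⊏j
      ... | inj₂ (l , q , refl) | inj₁ eq = contradiction (cong proj₁ eq) (Bool.not-¬ refl)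
      ... | inj₂ (l , q , refl) | inj₂ (eq , _) = contradiction eq (Bool.not-¬ refl)

      old<new : ∀ {i j} → rank i ℕ.< k → old i < new j
      old<new {i} {j} p with overtaken i p
      ... | l , q , i<l = <-trans i<l (extends _ (new j)
        (_ , encode-complete (Generator? j) _ (inj₂ (l , q , refl)) , inj₁ refl))

      below : ∀ {i j} → rank i ℕ.< suc k → ¬ (rank j ℕ.< k) → ¬ (rank j ℕ.< rank i)
      below p q r = q (ℕ.<-≤-trans r (ℕ.≤-pred p))

    extension : InitialEmbedding (suc k) (upward (double X)) _<_
    extension = record
      { embed    = λ i → choose i (rank i ℕ.<? k)
      ; preserve = λ {i} {j} p q → preserve (rank i ℕ.<? k) (rank j ℕ.<? k) p q
      ; reflect  = λ {i} {j} p q → reflect (rank i ℕ.<? k) (rank j ℕ.<? k) p q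
      ; ordered  = λ {i} {j} p q → ordered (rank i ℕ.<? k) (rank j ℕ.<? k) p q
      ; coloured = λ {i} _ → coloured (rank i ℕ.<? k)
      }
      where
      preserve : ∀ {i j} i? j? → rank i ℕ.< suc k → rank j ℕ.< suc k → i ⊏ j →
                 choose i i? Y.≺ choose j j?
      preserve (yes p) (yes q) _ _ i⊏j = refl , e.preserve p q i⊏j
      preserve (yes p) (no _)  _ _ i⊏j = old≺new p i⊏j
      -- Here `i` has the top rank `k`, so it precedes nothing under consideration.
      preserve (no p)  _       _ q i⊏j = contradiction (⊏⇒rank< i⊏j) (below q p)

      reflect : ∀ {i j} i? j? → rank i ℕ.< suc k → rank j ℕ.< suc k →
                choose i i? Y.≺ choose j j? → i ⊏ j
      -- A new point lies below nothing, so `i` must be old.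
      reflect (yes p) (yes q) _ _ (_ , i≺j) = e.reflect p q i≺j
      reflect (yes p) (no _)  _ _ i≺j = old≺new⁻ p i≺j

      ordered : ∀ {i j} i? j? → rank i ℕ.< suc k → rank j ℕ.< suc k → rank i ℕ.< rank j →
                choose i i? < choose j j?
      ordered (yes p) (yes q) _ _ r = e.ordered p q r
      ordered (yes p) (no _)  _ _ _ = old<new p
      ordered (no p)  _       _ q r = contradiction r (below q p)

      coloured : ∀ {i} i? → Y.colour (choose i i?) ≡ hue i
      coloured (yes p) = e.coloured p
      coloured (no _)  = refl

  -- Finite search decides which copy ends later. If some point of copy `true` is passed by nothing
  -- in copy `false`, then by connexity it comes after that whole embedding and `true` is the upper
  -- copy; otherwise every point of `true` is passed and `false` is the upper copy.
  extend : ∀ X k {_<_} → IsLinearExt (ColouredPoset._≺_ (upward (double X))) _<_ → Decidable _<_ →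
           (∀ b → InitialEmbedding k X (_<_ on λ x → inj₁ (b , x))) →
           InitialEmbedding (suc k) (upward (double X)) _<_
  extend X k {_<_} lin _<?_ half with Fin.any? unsurpassed?
    where
    Unsurpassed : Fin n → Set
    Unsurpassed i = rank i ℕ.< k × ∀ j → rank j ℕ.< k →
      ¬ (inj₁ (true , InitialEmbedding.embed (half true) i) < inj₁ (false , InitialEmbedding.embed (half false) j))
    unsurpassed? : Unary.Decidable Unsurpassed
    unsurpassed? i = (rank i ℕ.<? k) ×-dec Fin.all? λ j → (rank j ℕ.<? k) →-dec ¬? (_ <? _)
  ... | yes (i , p , last) = Extend.extension X k false lin (half false) (half true) λ j q →
    i , p , [ id , (λ i<j → contradiction i<j (last j q)) ] (IsLinearExt.connex lin _ _ λ ())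
  ... | no ¬last = Extend.extension X k true lin (half true) (half false) λ i p →
    decidable-stable (Fin.any? λ j → (rank j ℕ.<? k) ×-dec (_ <? _))
      λ ¬surpassed → ¬last (i , p , λ j q i<j → ¬surpassed (j , q , i<j))

  rich-ordering : ∀ k {_<_} → IsLinearExt (ColouredPoset._≺_ (rich k)) _<_ → Decidable _<_ →
                  InitialEmbedding k (rich k) _<_
  -- No rank is below 0, so any map will do.
  rich-ordering zero    _ _ = record
    { embed = λ _ → tt ; preserve = λ () ; reflect = λ () ; ordered = λ () ; coloured = λ () }
  rich-ordering (suc k) lin _<?_ = extend (rich k) k lin _<?_ λ b → rich-ordering k
    (linearExt-pullback lin (λ x → inj₁ (b , x)) (λ { refl → refl })
      λ x y x≺y → IsLinearExt.extends lin _ _ (refl , x≺y))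
    (λ x y → inj₁ (b , x) <? inj₁ (b , y))

-- Arithmetic of ℤ/3, checked exhaustively.

infixl 6 _⊕_ _⊖_

_⊕_ _⊖_ : Fin 3 → Fin 3 → Fin 3
a ⊕ b = (toℕ a + toℕ b) mod 3
a ⊖ b = (toℕ a + (3 ∸ toℕ b)) mod 3

≢⇒successor : ∀ a b → a ≢ b → b ≡ a ⊕ 1F ⊎ a ≡ b ⊕ 1F
≢⇒successor = toWitness {a? = Fin.all? λ a → Fin.all? λ b →
  ¬? (a Fin.≟ b) →-dec ((b Fin.≟ a ⊕ 1F) ⊎-dec (a Fin.≟ b ⊕ 1F))} tt

third-unique : ∀ (v w x y : Fin 3) → v ≢ w → x ≢ v → x ≢ w → y ≢ v → y ≢ w → x ≡ y
third-unique = toWitness {a? = Fin.all? λ v → Fin.all? λ w → Fin.all? λ x → Fin.all? λ y →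
  ¬? (v Fin.≟ w) →-dec ¬? (x Fin.≟ v) →-dec ¬? (x Fin.≟ w) →-dec
  ¬? (y Fin.≟ v) →-dec ¬? (y Fin.≟ w) →-dec (x Fin.≟ y)} tt

colDiff≡⊖ : ∀ a b → colDiff a b ≡ toℕ (b ⊖ a)
colDiff≡⊖ = toWitness {a? = Fin.all? λ a → Fin.all? λ b → colDiff a b ℕ.≟ toℕ (b ⊖ a)} tt

⊕-⊖ : ∀ a b → a ⊕ b ⊖ b ≡ a
⊕-⊖ = toWitness {a? = Fin.all? λ a → Fin.all? λ b → a ⊕ b ⊖ b Fin.≟ a} tt

⊖-⊕ : ∀ a b → a ⊖ b ⊕ b ≡ a
⊖-⊕ = toWitness {a? = Fin.all? λ a → Fin.all? λ b → a ⊖ b ⊕ b Fin.≟ a} tt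

⊕-⊖-self : ∀ a b → a ⊕ (b ⊖ b) ≡ a
⊕-⊖-self = toWitness {a? = Fin.all? λ a → Fin.all? λ b → a ⊕ (b ⊖ b) Fin.≟ a} tt

⊕-⊖-solve : ∀ a b t d → b ⊖ a ≡ t → b ≡ d ⊕ t → a ≡ d
⊕-⊖-solve = toWitness {a? = Fin.all? λ a → Fin.all? λ b → Fin.all? λ t → Fin.all? λ d →
  (b ⊖ a Fin.≟ t) →-dec (b Fin.≟ d ⊕ t) →-dec (a Fin.≟ d)} tt

⊕1-⊖ : ∀ a → a ⊕ 1F ⊖ a ≡ 1F
⊕1-⊖ = toWitness {a? = Fin.all? λ a → a ⊕ 1F ⊖ a Fin.≟ 1F} tt

⊖-flip : ∀ a b → a ⊖ b ≡ 0F ⊖ (b ⊖ a)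
⊖-flip = toWitness {a? = Fin.all? λ a → Fin.all? λ b → a ⊖ b Fin.≟ 0F ⊖ (b ⊖ a)} tt

⊖-flip-type : ∀ a b → 0F ⊖ (2F ⊖ (a ⊖ b)) ≡ 1F ⊖ (b ⊖ a)
⊖-flip-type = toWitness {a? = Fin.all? λ a → Fin.all? λ b → 0F ⊖ (2F ⊖ (a ⊖ b)) Fin.≟ 1F ⊖ (b ⊖ a)} tt

⊖-flip-type⁻ : ∀ a b → 0F ⊖ (1F ⊖ (b ⊖ a)) ≡ 2F ⊖ (a ⊖ b)
⊖-flip-type⁻ = toWitness {a? = Fin.all? λ a → Fin.all? λ b → 0F ⊖ (1F ⊖ (b ⊖ a)) Fin.≟ 2F ⊖ (a ⊖ b)} tt

-- Replacing one colour difference by another amounts to adding the difference of the switches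
-- `b ⊖ b′` and `a ⊖ a′`.
⊕-⊖-interchange : ∀ k a b a′ b′ → k ⊕ (b ⊖ a) ⊖ (b′ ⊖ a′) ≡ k ⊕ ((b ⊖ b′) ⊖ (a ⊖ a′))
⊕-⊖-interchange = toWitness {a? = Fin.all? λ k → Fin.all? λ a → Fin.all? λ b → Fin.all? λ a′ → Fin.all? λ b′ →
  k ⊕ (b ⊖ a) ⊖ (b′ ⊖ a′) Fin.≟ k ⊕ ((b ⊖ b′) ⊖ (a ⊖ a′))} tt

-- Switches that are constant on a copy.

Admissible : (B : ColouredPoset) → (ColouredPoset.Carrier B → Fin 3) → Set
Admissible B s = ∀ {i j x} → i ≢ j → ¬ (i ≺ j) → ¬ (j ≺ i) → i ≺ x → j ≺ x →
                 s j ≡ s i ⊕ 1F → s x ≢ s i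
  where open ColouredPoset B

record ConstantCopy (C B : ColouredPoset) (s : ColouredPoset.Carrier B → Fin 3) : Set where
  private
    module C = ColouredPoset C
    module B = ColouredPoset B
  field
    copy           : C.Carrier → B.Carrier
    copy-injective : Injective _≡_ _≡_ copy
    copy-≺         : ∀ {x y} → x C.≺ y ⇔ copy x B.≺ copy y
    copy-colour    : ∀ x → B.colour (copy x) ≡ C.colour x
    value          : Fin 3
    copy-constant  : ∀ x → s (copy x) ≡ value

-- In each layer `o` in copy `false` is the reference: a point of copy `true` with a different
-- switch forms an incomparable pair with it.
module _ (C : ColouredPoset) (o : ColouredPoset.Carrier C) where
  private
    B : ColouredPoset
    B = lex (chain 3) (double C)
    module B = ColouredPoset B
    module C = ColouredPoset C

  module _ (s : B.Carrier → Fin 3) (admissible : Admissible B s) where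

    -- Distinct elements of ℤ/3 differ by 1 in one direction, and the lost value is the one whose
    -- successor is the other.
    omitted : ∀ {i j} → i ≢ j → ¬ (i B.≺ j) → ¬ (j B.≺ i) → s i ≢ s j →
              ∃ λ v → (v ≡ s i ⊎ v ≡ s j) × ∀ x → i B.≺ x → j B.≺ x → s x ≢ v
    omitted {i} {j} i≢j i⊀j j⊀i si≢sj with ≢⇒successor (s i) (s j) si≢sj
    ... | inj₁ eq = s i , inj₁ refl , λ x p q → admissible i≢j i⊀j j⊀i p q eq
    ... | inj₂ eq = s j , inj₂ refl , λ x p q → admissible (i≢j ∘ sym) j⊀i i⊀j q p eq

    -- That `v` is attained in layer `l` is recorded so that it can be told apart from values lost
    -- in lower layers.
    layer-omits : ∀ l x → s (l , true , x) ≢ s (l , false , o) →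
                  ∃ λ v → (∃ λ z → s (l , z) ≡ v) ×
                    ∀ l′ z → l Data.Fin.< l′ → s (l′ , z) ≢ v
    layer-omits l x s≢ with omitted {l , true , x} {l , false , o} (λ ())
      [ Fin.<-irrefl refl , (λ { (_ , () , _) }) ] [ Fin.<-irrefl refl , (λ { (_ , () , _) }) ] s≢
    ... | v , inj₁ eq , omits = v , (_ , sym eq) , λ l′ z l<l′ → omits _ (inj₁ l<l′) (inj₁ l<l′)
    ... | v , inj₂ eq , omits = v , (_ , sym eq) , λ l′ z l<l′ → omits _ (inj₁ l<l′) (inj₁ l<l′)

    constant? : ∀ l → (∃ λ x → s (l , true , x) ≢ s (l , false , o)) ⊎
                      (∀ x → s (l , true , x) ≡ s (l , false , o))
    constant? l with C.any? (λ x → ¬? (s (l , true , x) Fin.≟ s (l , false , o)))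
    ... | yes p = inj₁ p
    ... | no ¬p = inj₂ λ x → decidable-stable (_ Fin.≟ _) λ q → ¬p (x , q)

    -- If layers 0 and 1 both vary, they lose values `v` and `w`. Since `w` is attained in layer 1,
    -- where `v` is already lost, the two differ, and layer 2 is left with a single value.
    constant-layer : ∃ λ l → ∃ λ t → ∀ x → s (l , true , x) ≡ t
    constant-layer with constant? 0F
    ... | inj₂ const₀ = 0F , _ , const₀
    ... | inj₁ (x₀ , s≢₀) with constant? 1F
    ...   | inj₂ const₁ = 1F , _ , const₁
    ...   | inj₁ (x₁ , s≢₁) with layer-omits 0F x₀ s≢₀ | layer-omits 1F x₁ s≢₁
    ...     | v , _ , omits-v | w , (z , sz≡w) , omits-w = 2F , s (2F , true , o) , λ x →
      third-unique v w _ _ (λ v≡w → omits-v 1F z (ℕ.s≤s ℕ.z≤n) (trans sz≡w (sym v≡w)))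
        (omits-v 2F _ (ℕ.s≤s ℕ.z≤n)) (omits-w 2F _ (ℕ.s≤s (ℕ.s≤s ℕ.z≤n)))
        (omits-v 2F _ (ℕ.s≤s ℕ.z≤n)) (omits-w 2F _ (ℕ.s≤s (ℕ.s≤s ℕ.z≤n)))

    constant-copy : ConstantCopy C B s
    constant-copy with constant-layer
    ... | l , t , const = record
      { copy           = λ x → l , true , x
      ; copy-injective = λ { refl → refl }
      ; copy-≺         = mk⇔ (λ x≺y → inj₂ (refl , refl , x≺y))
          [ (λ l<l → contradiction l<l (Fin.<-irrefl refl)) , proj₂ ∘ proj₂ ]
      ; copy-colour    = λ _ → refl
      ; value          = t
      ; copy-constant  = const
      }

-- Types of pairs, and twisting between order and digraph.

-- T^R_k of the paper, with 2F standing for k = -1.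
Type : {P : Set} → (P → P → Set) → Fin 3 → P → P → Set
Type R 0F x y = x ≢ y × ¬ R x y × ¬ R y x
Type R 1F x y = R y x
Type R 2F x y = R x y

type-flip : ∀ {P : Set} {R : P → P → Set} k {x y} → Type R k x y → Type R (0F ⊖ k) y x
type-flip 0F (x≢y , p , q) = x≢y ∘ sym , q , p
type-flip 1F p = p
type-flip 2F p = p

type-map : ∀ {P : Set} {R : P → P → Set} k {x y x′ y′} → (x ≢ y → x′ ≢ y′) →
           R x y ⇔ R x′ y′ → R y x ⇔ R y′ x′ → Type R k x y → Type R k x′ y′
type-map 0F ≢-map r r′ (x≢y , p , q) =
  ≢-map x≢y , p ∘ Equivalence.from r , q ∘ Equivalence.from r′
type-map 1F _ _ r′ = Equivalence.to r′
type-map 2F _ r _ = Equivalence.to r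

type-unique : ∀ {P : Set} {R : P → P → Set} → (∀ {x y} → R x y → ¬ R y x) →
              ∀ k k′ {x y} → Type R k x y → Type R k′ x y → k ≡ k′
type-unique asym 0F 0F _ _ = refl
type-unique asym 1F 1F _ _ = refl
type-unique asym 2F 2F _ _ = refl
type-unique asym 0F 1F (_ , _ , q) r = contradiction r q
type-unique asym 0F 2F (_ , q , _) r = contradiction r q
type-unique asym 1F 0F r (_ , _ , q) = contradiction r q
type-unique asym 2F 0F r (_ , q , _) = contradiction r q
type-unique asym 1F 2F p q = contradiction q (asym p)
type-unique asym 2F 1F p q = contradiction q (asym p)

type-≢ : ∀ {P : Set} {R : P → P → Set} → (∀ {x} → ¬ R x x) → ∀ k {x y} → Type R k x y → x ≢ y
type-≢ irrefl 0F (x≢y , _) = x≢y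
type-≢ irrefl 1F p refl = irrefl p
type-≢ irrefl 2F p refl = irrefl p

-- No decidability of `R` is assumed, hence the double negation, which `untwist` and everything
-- built on it inherit.
type-¬¬total : ∀ {P : Set} {R : P → P → Set} {x y} → x ≢ y → ¬ ¬ (∃ λ k → Type R k x y)
type-¬¬total x≢y ¬t = ¬t (0F , x≢y , (λ p → ¬t (2F , p)) , (λ p → ¬t (1F , p)))

module Twist {P : Set} {_≺_ : P → P → Set} (col : P → Fin 3)
             (spo : IsStrictPartialOrder _≡_ _≺_) where
  open IsStrictPartialOrder spo using (asym) renaming (irrefl to ≺-irrefl)

  private
    _⟶_ : P → P → Set
    _⟶_ = Edge _≺_ col

    δ : P → P → Fin 3
    δ x y = col y ⊖ col x

    δ-value : ∀ {x y} d → colDiff (col x) (col y) ≡ toℕ d → δ x y ≡ d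
    δ-value {x} {y} d eq = Fin.toℕ-injective (trans (sym (colDiff≡⊖ (col x) (col y))) eq)

  -- The three disjuncts of `Edge` solve k + δ = -1 for k, one for each value of δ.
  edge⇒type : ∀ {x y} → x ⟶ y → Type _≺_ (2F ⊖ δ x y) x y
  edge⇒type {x} {y} (inj₁ (p , eq)) rewrite δ-value {x} {y} 0F eq = p
  edge⇒type {x} {y} (inj₂ (inj₁ (p , eq))) rewrite δ-value {x} {y} 1F eq = p
  edge⇒type {x} {y} (inj₂ (inj₂ (p , q , r , eq))) rewrite δ-value {x} {y} 2F eq = p , q , r

  type⇒edge : ∀ {x y} → Type _≺_ (2F ⊖ δ x y) x y → x ⟶ y
  type⇒edge {x} {y} t with δ x y | colDiff≡⊖ (col x) (col y)
  ... | 0F | eq = inj₁ (t , eq)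
  ... | 1F | eq = inj₂ (inj₁ (t , eq))
  ... | 2F | eq = inj₂ (inj₂ (proj₁ t , proj₁ (proj₂ t) , proj₂ (proj₂ t) , eq))

  edge⇒typeʳ : ∀ {x y} → y ⟶ x → Type _≺_ (1F ⊖ δ x y) x y
  edge⇒typeʳ {x} {y} e = subst (λ k → Type _≺_ k x y) (⊖-flip-type (col x) (col y))
    (type-flip (2F ⊖ δ y x) (edge⇒type e))

  type⇒edgeʳ : ∀ {x y} → Type _≺_ (1F ⊖ δ x y) x y → y ⟶ x
  type⇒edgeʳ {x} {y} t = type⇒edge (subst (λ k → Type _≺_ k y x) (⊖-flip-type⁻ (col x) (col y))
    (type-flip (1F ⊖ δ x y) t))

  ≺-type-unique : ∀ k k′ {x y} → Type _≺_ k x y → Type _≺_ k′ x y → k ≡ k′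
  ≺-type-unique = type-unique asym

  edge-≢ : ∀ {x y} → x ⟶ y → x ≢ y
  edge-≢ {x} {y} e = type-≢ (≺-irrefl refl) (2F ⊖ δ x y) (edge⇒type e)

  edge-asym : ∀ {x y} → x ⟶ y → ¬ (y ⟶ x)
  -- Edges both ways would give the same pair the types 2 - δ and 1 - δ.
  edge-asym {x} {y} e e′ with trans (sym (⊖-⊕ 2F (δ x y)))
    (trans (cong (_⊕ δ x y) (≺-type-unique (2F ⊖ δ x y) (1F ⊖ δ x y) (edge⇒type e) (edge⇒typeʳ e′))) (⊖-⊕ 1F (δ x y)))
  ... | ()

  -- Recovers the rule for all three edge types from `Edge`, which lists only the pairs of type -1.
  -- In the remaining case 0, an edge in either direction would make the value 2 or 1.
  twist : ∀ k {x y} → Type _≺_ k x y → Type _⟶_ (k ⊕ δ x y) x y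
  twist k {x} {y} t with k ⊕ δ x y in eq
  ... | 2F = type⇒edge (subst (λ k → Type _≺_ k x y) (trans (sym (⊕-⊖ k (δ x y))) (cong (_⊖ δ x y) eq)) t)
  ... | 1F = type⇒edgeʳ (subst (λ k → Type _≺_ k x y) (trans (sym (⊕-⊖ k (δ x y))) (cong (_⊖ δ x y) eq)) t)
  ... | 0F = type-≢ (≺-irrefl refl) k t , ¬xy , ¬yx
    where
    value : ∀ v → Type _≺_ (v ⊖ δ x y) x y → v ≡ 0F
    value v t′ = trans (sym (⊖-⊕ v (δ x y))) (trans (cong (_⊕ δ x y) (≺-type-unique (v ⊖ δ x y) k t′ t)) eq)
    ¬xy : ¬ (x ⟶ y)
    ¬xy e with value 2F (edge⇒type e)
    ... | ()
    ¬yx : ¬ (y ⟶ x)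
    ¬yx e with value 1F (edge⇒typeʳ e)
    ... | ()

  -- Some order type exists up to double negation; twisting it gives an edge type, which is unique
  -- and so must be `k`.
  untwist : ∀ k {x y} → Type _⟶_ k x y → ¬ ¬ Type _≺_ (k ⊖ δ x y) x y
  untwist k {x} {y} t = ¬¬-map
    (λ (k′ , t′) → subst (λ k → Type _≺_ k x y)
      (trans (sym (⊕-⊖ k′ (δ x y))) (cong (_⊖ δ x y) (type-unique edge-asym (k′ ⊕ δ x y) k (twist k′ t′) t))) t′)
    (type-¬¬total (type-≢ (λ e → edge-≢ e refl) k t))

  -- Twist with the old colours, pass through the common digraph, untwist with the new ones.
  transfer : ∀ k {x y x′ y′} → (∀ k → Type _⟶_ k x y → Type _⟶_ k x′ y′) → Type _≺_ k x y →
             ¬ ¬ Type _≺_ (k ⊕ ((col y ⊖ col y′) ⊖ (col x ⊖ col x′))) x′ y′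
  transfer k {x} {y} {x′} {y′} f t =
    subst (λ k → ¬ ¬ Type _≺_ k x′ y′) (⊕-⊖-interchange k (col x) (col y) (col x′) (col y′))
      (untwist (k ⊕ δ x y) (f (k ⊕ δ x y) (twist k t)))

  edge? : ∀ {x y} → Dec (x ≡ y) → Dec (x ≺ y) → Dec (y ≺ x) → Dec (x ⟶ y)
  edge? x≟y x≺?y y≺?x = (x≺?y ×-dec (_ ℕ.≟ 0)) ⊎-dec (y≺?x ×-dec (_ ℕ.≟ 1)) ⊎-dec
    (¬? x≟y ×-dec ¬? x≺?y ×-dec ¬? y≺?x ×-dec (_ ℕ.≟ 2))

  -- Edge type and colours single out the only possible order type, so it suffices to test whether
  -- that one is -1.
  ¬¬≺? : ∀ {x y} → Dec (x ≡ y) → Dec (x ⟶ y) → Dec (y ⟶ x) → Dec (¬ ¬ (x ≺ y))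
  ¬¬≺? (yes refl) _ _ = no λ ¬¬p → ¬¬p (≺-irrefl refl)
  ¬¬≺? {x} {y} (no x≢y) e? e′? = decide (edge-type e? e′?)
    where
    edge-type : Dec (x ⟶ y) → Dec (y ⟶ x) → ∃ λ k → Type _⟶_ k x y
    edge-type (yes e) _        = 2F , e
    edge-type (no _)  (yes e)  = 1F , e
    edge-type (no ¬e) (no ¬e′) = 0F , x≢y , ¬e , ¬e′
    decide : (∃ λ k → Type _⟶_ k x y) → Dec (¬ ¬ (x ≺ y))
    decide (k , t) with k ⊖ δ x y Fin.≟ 2F
    ... | yes eq = yes (subst (λ k → ¬ ¬ Type _≺_ k x y) eq (untwist k t))
    ... | no neq = no λ ¬¬p → ¬¬p λ p → untwist k t λ t′ → neq (≺-type-unique (k ⊖ δ x y) 2F t′ p)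

  edge-¬¬map : ∀ {x y x′ y′} → (x ≢ y → x′ ≢ y′) → col x ≡ col x′ → col y ≡ col y′ →
    (¬ ¬ (x ≺ y)) ⇔ (¬ ¬ (x′ ≺ y′)) → (¬ ¬ (y ≺ x)) ⇔ (¬ ¬ (y′ ≺ x′)) → x ⟶ y → ¬ ¬ (x′ ⟶ y′)
  edge-¬¬map ≢-map cx cy f g e rewrite cx | cy with e
  ... | inj₁ (p , eq) = ¬¬-map (λ p′ → inj₁ (p′ , eq)) (Equivalence.to f (λ ¬p → ¬p p))
  ... | inj₂ (inj₁ (p , eq)) = ¬¬-map (λ p′ → inj₂ (inj₁ (p′ , eq))) (Equivalence.to g (λ ¬p → ¬p p))
  ... | inj₂ (inj₂ (x≢y , p , q , eq)) = λ ¬e → ¬e (inj₂ (inj₂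
    (≢-map x≢y , (λ p′ → Equivalence.from f (λ ¬p′ → ¬p′ p′) p) , 
     (λ q′ → Equivalence.from g (λ ¬q′ → ¬q′ q′) q) , eq)))

  edge-≡ : ∀ {b b′} {x y x′ y′} → b ≡ true ⇔ x ⟶ y → b′ ≡ true ⇔ x′ ⟶ y′ →
    (x ≢ y → x′ ≢ y′) → (x′ ≢ y′ → x ≢ y) → col x ≡ col x′ → col y ≡ col y′ →
    (¬ ¬ (x ≺ y)) ⇔ (¬ ¬ (x′ ≺ y′)) → (¬ ¬ (y ≺ x)) ⇔ (¬ ¬ (y′ ≺ x′)) → b ≡ b′
  edge-≡ {b} {b′} {x} {y} {x′} {y′} β β′ ≢-map ≢-map⁻ cx cy f g = Bool.⇔→≡ {z = true} (mk⇔
    (λ p → decidable-stable (b′ Bool.≟ true) (¬¬-map (Equivalence.from β′)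
      (edge-¬¬map {x} {y} {x′} {y′} ≢-map cx cy f g (Equivalence.to β p))))
    (λ p → decidable-stable (b Bool.≟ true) (¬¬-map (Equivalence.from β)
      (edge-¬¬map {x′} {y′} {x} {y} ≢-map⁻ (sym cx) (sym cy) (⇔-sym f) (⇔-sym g) (Equivalence.to β′ p)))))

  transfer-aligned : ∀ k {x y x′ y′} → (∀ k → Type _⟶_ k x y → Type _⟶_ k x′ y′) →
    col x ⊖ col x′ ≡ col y ⊖ col y′ → Type _≺_ k x y → ¬ ¬ Type _≺_ k x′ y′
  transfer-aligned k {x} {y} {x′} {y′} f eq t = subst (λ k → ¬ ¬ Type _≺_ k x′ y′)
    (trans (cong (λ c → k ⊕ (c ⊖ (col x ⊖ col x′))) (sym eq)) (⊕-⊖-self k (col x ⊖ col x′)))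
    (transfer k f t)

  -- A switch larger by 1 at `y` rotates the type: incomparable becomes `y′ ≺ x′`, `y ≺ x` becomes
  -- `x′ ≺ y′`, and `x ≺ y` becomes incomparable. This produces the forbidden cycle.
  transfer-successor : ∀ k {x y x′ y′} → (∀ k → Type _⟶_ k x y → Type _⟶_ k x′ y′) →
    col y ⊖ col y′ ≡ col x ⊖ col x′ ⊕ 1F → Type _≺_ k x y → ¬ ¬ Type _≺_ (k ⊕ 1F) x′ y′
  transfer-successor k {x} {y} {x′} {y′} f eq t = subst (λ k → ¬ ¬ Type _≺_ k x′ y′)
    (cong (k ⊕_) (trans (cong (_⊖ (col x ⊖ col x′)) eq) (⊕1-⊖ (col x ⊖ col x′))))
    (transfer k f t)

-- Realising finite coloured posets in the generic order.

does-≡true : ∀ {A : Set} (A? : Dec A) → does A? ≡ true ⇔ A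
does-≡true (yes a) = mk⇔ (λ _ → a) (λ _ → refl)
does-≡true (no ¬a) = mk⇔ (λ ()) (λ a → contradiction a ¬a)

record Realisation {P : Set} (_≺_ : P → P → Set) (col : P → Fin 3) (X : ColouredPoset) : Set where
  private
    module X = ColouredPoset X
  field
    place           : X.Carrier → P
    place-injective : Injective _≡_ _≡_ place
    place-≺         : ∀ x y → x X.≺ y ⇔ place x ≺ place y
    place-colour    : ∀ x → col (place x) ≡ X.colour x

module _ {P : Set} {_≺_ : P → P → Set} (generic : IsGenericPO P _≺_) where
  open IsGenericPO generic
  open IsStrictPartialOrder isSPO using () renaming (irrefl to ≺-irrefl; trans to ≺-trans)

  universal-poset : ∀ X → Σ (ColouredPoset.Carrier X → P) λ f →
                    ∀ x y → ColouredPoset._≺_ X x y ⇔ f x ≺ f y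
  universal-poset X = f ∘ index , λ x y → mk⇔
      (λ x≺y → Equivalence.to (f-≺ _ _) (Equivalence.from (does-≡true (_ ≺? _))
        (subst₂ X._≺_ (sym (point-index x)) (sym (point-index y)) x≺y)))
      (λ fx≺fy → subst₂ X._≺_ (point-index x) (point-index y)
        (Equivalence.to (does-≡true (_ ≺? _)) (Equivalence.from (f-≺ _ _) fx≺fy)))
    where
    module X = ColouredPoset X
    open X using (size; point; index; point-index; _≺?_)
    R : Fin size → Fin size → Bool
    R i j = does (point i ≺? point j)
    to : ∀ i j → R i j ≡ true → point i X.≺ point j
    to i j = Equivalence.to (does-≡true (point i ≺? point j))
    R-isFinPoset : IsFinPoset R
    R-isFinPoset = isSPO-≡ (λ {i} → X.irrefl ∘ to i i)
      (λ {i} {j} {k} p q → Equivalence.from (does-≡true (point i ≺? point k))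
        (X.≺-trans (to i j p) (to j k q)))
    f = proj₁ (universal size R R-isFinPoset)
    f-≺ = proj₂ (proj₂ (universal size R R-isFinPoset))

  -- Realise every point by an interval; density then supplies the colours.
  realise : ∀ {col} → (∀ c → DenseColour _≺_ col c) → ∀ X → Realisation _≺_ col X
  realise {col} dense X = record
    { place           = f
    ; place-injective = f-injective
    ; place-≺         = λ x y → mk⇔ f-mono f-reflect
    ; place-colour    = λ x → proj₁ (proj₂ (between x))
    }
    where
    module X = ColouredPoset X
    g = proj₁ (universal-poset (lex X (chain 2)))
    g-≺ = proj₂ (universal-poset (lex X (chain 2)))
    between : ∀ x → ∃ λ y → col y ≡ X.colour x × g (x , 0F) ≺ y × y ≺ g (x , 1F)
    between x = dense (X.colour x) _ _ (Equivalence.to (g-≺ _ _) (inj₂ (refl , ℕ.s≤s ℕ.z≤n)))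
    f : X.Carrier → P
    f x = proj₁ (between x)
    above : ∀ x → g (x , 0F) ≺ f x
    above x = proj₁ (proj₂ (proj₂ (between x)))
    below : ∀ x → f x ≺ g (x , 1F)
    below x = proj₂ (proj₂ (proj₂ (between x)))
    f-mono : ∀ {x y} → x X.≺ y → f x ≺ f y
    f-mono {x} {y} x≺y = ≺-trans (below x) (≺-trans (Equivalence.to (g-≺ _ _) (inj₁ x≺y)) (above y))
    -- Choosing points inside the intervals creates no new comparabilities: the lower end of one
    -- interval lies below the upper end of another only when the lexicographic order says so.
    interval : ∀ {x y} → g (x , 0F) ≺ g (y , 1F) → x X.≺ y ⊎ x ≡ y
    interval p with Equivalence.from (g-≺ _ _) p
    ... | inj₁ x≺y = inj₁ x≺y
    ... | inj₂ (x≡y , _) = inj₂ x≡y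
    f-reflect : ∀ {x y} → f x ≺ f y → x X.≺ y
    f-reflect {x} {y} p with interval (≺-trans (above x) (≺-trans p (below y)))
    ... | inj₁ x≺y = x≺y
    ... | inj₂ refl = contradiction p (≺-irrefl refl)
    f-injective : Injective _≡_ _≡_ f
    f-injective {x} {y} eq with interval (≺-trans (above x) (subst (_≺ g (y , 1F)) (sym eq) (below y)))
    ... | inj₁ x≺y = contradiction (f-mono x≺y) (≺-irrefl eq)
    ... | inj₂ x≡y = x≡y

-- Ranks from counting predecessors in a linear order.

predecessors : ∀ {n} → (Fin n → Fin n → Bool) → Fin n → Subset n
predecessors L i = tabulate λ j → L j i

∈-predecessors : ∀ {n} (L : Fin n → Fin n → Bool) {i j} → j ∈ predecessors L i ⇔ L j i ≡ true
∈-predecessors L {i} {j} = mk⇔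
  (λ p → trans (sym (lookup∘tabulate _ j)) ([]=⇒lookup p))
  (λ p → lookup⇒[]= j _ (trans (lookup∘tabulate _ j) p))

height : ∀ {n} → (Fin n → Fin n → Bool) → Fin n → ℕ
height L i = ∣ predecessors L i ∣

height-mono : ∀ {n} {L : Fin n → Fin n → Bool} → IsFinPoset L →
              ∀ {i j} → L i j ≡ true → height L i ℕ.< height L j
height-mono {L = L} po {i} {j} i<j = p⊂q⇒∣p∣<∣q∣
  ( (λ k∈ → from (PO.trans (to k∈) i<j))
  , i , from i<j , λ i∈ → PO.irrefl refl (to i∈))
  where
  module PO = IsStrictPartialOrder po
  to : ∀ {i j} → j ∈ predecessors L i → L j i ≡ true
  to = Equivalence.to (∈-predecessors L)
  from : ∀ {i j} → L j i ≡ true → j ∈ predecessors L i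
  from = Equivalence.from (∈-predecessors L)

-- Embeddings between expansions.

basePoint : ∀ k → ColouredPoset.Carrier (rich k)
basePoint zero    = tt
basePoint (suc k) = inj₁ (true , basePoint k)

module _ {P : Set} {_≺_ _<_ : P → P → Set} (lin : IsLinearExt _≺_ _<_)
         {n : ℕ} {f : Fin n → P} {L : Fin n → Fin n → Bool} (f-< : ∀ i j → L i j ≡ true ⇔ f i < f j) where
  open IsLinearExt lin
  open IsStrictPartialOrder isSPO using () renaming (irrefl to <-irrefl; trans to <-trans)

  order-isFinPoset : IsFinPoset L
  order-isFinPoset = isSPO-≡ (λ {i} p → <-irrefl refl (Equivalence.to (f-< i i) p))
    λ {i} {j} {k} p q → Equivalence.from (f-< i k)
      (<-trans (Equivalence.to (f-< i j) p) (Equivalence.to (f-< j k) q))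

  order-total : Injective _≡_ _≡_ f → ∀ {i j} → i ≢ j → L i j ≡ true ⊎ L j i ≡ true
  order-total f-injective {i} {j} i≢j = Sum.map (Equivalence.from (f-< i j)) (Equivalence.from (f-< j i))
    (connex (f i) (f j) (i≢j ∘ f-injective))

-- Preserving the order suffices, as totality turns it into injectivity and reflection; edges are
-- determined by colours and the partial order.
embeds* : ∀ {P : Set} {_≺_ : P → P → Set} (col : P → Fin 3) {_<_ : P → P → Set} →
  IsStrictPartialOrder _≡_ _≺_ → IsLinearExt _≺_ _<_ →
  ∀ {n E c L} ((f , _) : InAgeP3* _≺_ col _<_ n E c L)
    {m E′ c′ L′} ((f′ , _) : InAgeP3* _≺_ col _<_ m E′ c′ L′) (g : Fin n → Fin m) →
  (∀ i → col (f i) ≡ col (f′ (g i))) →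
  (∀ i j → (¬ ¬ (f i ≺ f j)) ⇔ (¬ ¬ (f′ (g i) ≺ f′ (g j)))) →
  (∀ {i j} → L i j ≡ true → f′ (g i) < f′ (g j)) →
  Embeds* n E c L m E′ c′ L′
embeds* col {_<_} isSPO lin {E = E} {L = L} (f , f-injective , f-edge , f-colour , f-<)
        {E′ = E′} (f′ , f′-injective , f′-edge , f′-colour , f′-<) g g-colour g-≺ g-ordered =
    g , g-injective , g-edge ,
    (λ i → trans (f-colour i) (trans (g-colour i) (sym (f′-colour (g i))))) ,
    λ i j → Bool.⇔→≡ {z = true} (mk⇔
      (λ p → Equivalence.from (f′-< (g i) (g j)) (g-ordered p))
      (λ p → g-reflects (Equivalence.to (f′-< (g i) (g j)) p)))
  where
  open IsStrictPartialOrder (IsLinearExt.isSPO lin) using () renaming (irrefl to <-irrefl; trans to <-trans)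

  g-injective : Injective _≡_ _≡_ g
  g-injective {i} {j} eq = decidable-stable (i Fin.≟ j) λ i≢j →
    [ (λ p → <-irrefl (cong f′ eq) (g-ordered p))
    , (λ p → <-irrefl (cong f′ (sym eq)) (g-ordered p)) ] (order-total lin f-< f-injective i≢j)

  g-reflects : ∀ {i j} → f′ (g i) < f′ (g j) → L i j ≡ true
  g-reflects {i} {j} p = decidable-stable (L i j Bool.≟ true) λ i≮j →
    [ i≮j , (λ j<i → <-irrefl refl (<-trans p (g-ordered j<i))) ]
      (order-total lin f-< f-injective λ i≡j → <-irrefl (cong (f′ ∘ g) i≡j) p)

  g-edge : ∀ i j → E i j ≡ E′ (g i) (g j)
  g-edge i j = Twist.edge-≡ col isSPO (f-edge i j) (f′-edge (g i) (g j))
    (λ p → p ∘ cong f ∘ g-injective ∘ f′-injective) (λ p → p ∘ cong (f′ ∘ g) ∘ f-injective)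
    (g-colour i) (g-colour j) (g-≺ i j) (g-≺ j i)

-- Comparing two placements of one digraph.

module Expansion {P : Set} {_≺_ : P → P → Set} (col : P → Fin 3) {_<_ : P → P → Set}
  (isSPO : IsStrictPartialOrder _≡_ _≺_) (lin : IsLinearExt _≺_ _<_)
  (n : ℕ) (E : Fin n → Fin n → Bool) (C B : ColouredPoset)
  (copies : ∀ s → Admissible B s → ConstantCopy C B s)
  (C-ordering : ∀ (A : RankedPoset n) {_<_} → IsLinearExt (ColouredPoset._≺_ C) _<_ →
                Decidable _<_ → InitialEmbedding A (suc n) C _<_)
  (realisation : Realisation _≺_ col B)
  (E′ : Fin (ColouredPoset.size B) → Fin (ColouredPoset.size B) → Bool)
  (E′-edge : ∀ i j → E′ i j ≡ true ⇔ Edge _≺_ col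
    (Realisation.place realisation (ColouredPoset.point B i))
    (Realisation.place realisation (ColouredPoset.point B j))) where

  private
    module C = ColouredPoset C
    module B = ColouredPoset B

  open Realisation realisation
    renaming (place to f₀; place-injective to f₀-injective; place-≺ to f₀-≺; place-colour to f₀-colour)
  open IsStrictPartialOrder isSPO using () renaming (irrefl to ≺-irrefl; trans to ≺-trans)
  open IsLinearExt lin using (extends)
  open Twist col isSPO

  module _ {c : Fin n → Fin 3} {L : Fin n → Fin n → Bool} (A* : InAgeP3* _≺_ col _<_ n E c L)
           {c′ : Fin B.size → Fin 3} {L′ : Fin B.size → Fin B.size → Bool}
           (B* : InAgeP3* _≺_ col _<_ B.size E′ c′ L′) where
    private
      f : Fin n → P
      f = proj₁ A*

      f-injective : Injective _≡_ _≡_ f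
      f-injective = proj₁ (proj₂ A*)

      f-edge : ∀ i j → E i j ≡ true ⇔ Edge _≺_ col (f i) (f j)
      f-edge = proj₁ (proj₂ (proj₂ A*))

      f-< : ∀ i j → L i j ≡ true ⇔ f i < f j
      f-< = proj₂ (proj₂ (proj₂ (proj₂ A*)))

      f′ : Fin B.size → P
      f′ = proj₁ B*

      f′-injective : Injective _≡_ _≡_ f′
      f′-injective = proj₁ (proj₂ B*)

      f′-edge : ∀ i j → E′ i j ≡ true ⇔ Edge _≺_ col (f′ i) (f′ j)
      f′-edge = proj₁ (proj₂ (proj₂ B*))

      f′-< : ∀ i j → L′ i j ≡ true ⇔ f′ i < f′ j
      f′-< = proj₂ (proj₂ (proj₂ (proj₂ B*)))

      h : B.Carrier → P
      h = f′ ∘ B.index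

      h-injective : Injective _≡_ _≡_ h
      h-injective = B.index-injective ∘ f′-injective

      h-edge : ∀ x y → Edge _≺_ col (f₀ x) (f₀ y) ⇔ Edge _≺_ col (h x) (h y)
      h-edge x y = subst₂ (λ u v → Edge _≺_ col (f₀ u) (f₀ v) ⇔ Edge _≺_ col (h x) (h y))
        (B.point-index x) (B.point-index y)
        (⇔-trans (⇔-sym (E′-edge (B.index x) (B.index y))) (f′-edge (B.index x) (B.index y)))

      h-type : ∀ {x y} k → Type (Edge _≺_ col) k (f₀ x) (f₀ y) → Type (Edge _≺_ col) k (h x) (h y)
      h-type {x} {y} k = type-map k (λ p → p ∘ cong f₀ ∘ h-injective) (h-edge x y) (h-edge y x)

      h-type⁻ : ∀ {x y} k → Type (Edge _≺_ col) k (h x) (h y) → Type (Edge _≺_ col) k (f₀ x) (f₀ y)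
      h-type⁻ {x} {y} k = type-map k (λ p → p ∘ cong h ∘ f₀-injective)
        (⇔-sym (h-edge x y)) (⇔-sym (h-edge y x))

      -- The switch between the chosen placement `f₀` and the placement `h` given by an arbitrary
      -- expansion of the same digraph.
      s : B.Carrier → Fin 3
      s x = col (f₀ x) ⊖ col (h x)

      -- i, x, j would form a cycle of the order read off from h.
      admissible : Admissible B s
      admissible {i} {j} {x} i≢j i⊀j j⊀i i≺x j≺x sj≡ sx≡ =
        transfer-successor 0F h-type sj≡
          (i≢j ∘ f₀-injective , i⊀j ∘ Equivalence.from (f₀-≺ i j) , j⊀i ∘ Equivalence.from (f₀-≺ j i))
          λ j≺i → transfer-aligned 2F h-type (sym sx≡) (Equivalence.to (f₀-≺ i x) i≺x)
          λ i≺x → transfer-successor 1F h-type (trans sj≡ (cong (_⊕ 1F) (sym sx≡)))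
            (Equivalence.to (f₀-≺ j x) j≺x)
          λ x≺j → ≺-irrefl refl (≺-trans j≺i (≺-trans i≺x x≺j))

      open ConstantCopy (copies s admissible) renaming (copy to κ; value to t)

      s-aligned : ∀ x y → s (κ x) ≡ s (κ y)
      s-aligned x y = trans (copy-constant x) (sym (copy-constant y))

      -- Where the switch is constant, colour differences agree in both placements, so the digraph
      -- determines the same order types.
      hκ-≺ : ∀ x y → x C.≺ y ⇔ (¬ ¬ (h (κ x) ≺ h (κ y)))
      hκ-≺ x y = mk⇔
        (λ x≺y → transfer-aligned 2F h-type (s-aligned x y)
          (Equivalence.to (f₀-≺ (κ x) (κ y)) (Equivalence.to copy-≺ x≺y)))
        (λ ¬¬p → decidable-stable (x C.≺? y) λ x⊀y → ¬¬p λ p →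
          transfer-aligned 2F h-type⁻ s-aligned⁻ p
            (x⊀y ∘ Equivalence.from copy-≺ ∘ Equivalence.from (f₀-≺ (κ x) (κ y))))
        where
        s-aligned⁻ : col (h (κ x)) ⊖ col (f₀ (κ x)) ≡ col (h (κ y)) ⊖ col (f₀ (κ y))
        s-aligned⁻ = trans (⊖-flip (col (h (κ x))) (col (f₀ (κ x))))
          (trans (cong (0F ⊖_) (s-aligned x y)) (sym (⊖-flip (col (h (κ y))) (col (f₀ (κ y))))))

      h<? : ∀ x y → Dec (h x < h y)
      h<? x y = Dec.map (f′-< (B.index x) (B.index y)) (L′ (B.index x) (B.index y) Bool.≟ true)

      C-linear : IsLinearExt C._≺_ (_<_ on (h ∘ κ))
      C-linear = linearExt-pullback lin (h ∘ κ) (copy-injective ∘ h-injective)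
        λ x y x≺y → decidable-stable (h<? (κ x) (κ y))
          (¬¬-map (extends _ _) (Equivalence.to (hκ-≺ x y) x≺y))

      height-injective : Injective _≡_ _≡_ (height L)
      height-injective {i} {j} eq = decidable-stable (i Fin.≟ j) λ i≢j →
        [ (λ i<j → ℕ.<-irrefl eq (height-mono (order-isFinPoset lin f-<) i<j))
        , (λ j<i → ℕ.<-irrefl (sym eq) (height-mono (order-isFinPoset lin f-<) j<i)) ]
        (order-total lin f-< f-injective i≢j)

      f-edge? : ∀ i j → Dec (Edge _≺_ col (f i) (f j))
      f-edge? i j = Dec.map (f-edge i j) (E i j Bool.≟ true)

      -- The edges and colours determine ≺ only up to double negation, which is
      -- enough because all relations to be compared at the end are Boolean.
      A : RankedPoset n
      A = record
        { _⊏_ = λ i j → ¬ ¬ (f i ≺ f j)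
        ; _⊏?_ = λ i j → ¬¬≺? (map′ (cong f) f-injective (i Fin.≟ j)) (f-edge? i j) (f-edge? j i)
        ; ⊏-trans = λ ¬¬p ¬¬q ¬r → ¬¬p λ p → ¬¬q λ q → ¬r (≺-trans p q)
        ; rank = height L
        ; rank-injective = height-injective
        ; ⊏⇒rank< = λ {i} {j} ¬¬p → height-mono (order-isFinPoset lin f-<)
            (decidable-stable (L i j Bool.≟ true)
              (¬¬-map (Equivalence.from (f-< i j) ∘ extends _ _) ¬¬p))
        -- On the copy, colours in `h` are those of `C` minus `t`; the shift by `t` compensates for
        -- this.
        ; hue = λ i → col (f i) ⊕ t
        }

      ranked : ∀ i → height L i ℕ.< suc n
      -- The bound of a subset's size by `n` accounts for the `suc n` in `C-ordering`.
      ranked i = ℕ.s≤s (∣p∣≤n (predecessors L i))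

      open InitialEmbedding (C-ordering A C-linear λ x y → h<? (κ x) (κ y))

      g : Fin n → Fin B.size
      g i = B.index (κ (embed i))

      g-ordered : ∀ {i j} → L i j ≡ true → f′ (g i) < f′ (g j)
      g-ordered {i} {j} p = ordered (ranked i) (ranked j) (height-mono (order-isFinPoset lin f-<) p)

      g-colour : ∀ i → col (f i) ≡ col (f′ (g i))
      g-colour i = sym (⊕-⊖-solve (col (f′ (g i))) (col (f₀ (κ (embed i)))) t (col (f i)) (copy-constant (embed i))
        (trans (f₀-colour (κ (embed i))) (trans (copy-colour (embed i)) (coloured (ranked i)))))

      g-≺ : ∀ i j → (¬ ¬ (f i ≺ f j)) ⇔ (¬ ¬ (f′ (g i) ≺ f′ (g j)))
      g-≺ i j = ⇔-trans (mk⇔ (preserve (ranked i) (ranked j)) (reflect (ranked i) (ranked j)))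
        (hκ-≺ (embed i) (embed j))

    embeds : Embeds* n E c L B.size E′ c′ L′
    embeds = embeds* col isSPO lin A* B* g g-colour g-≺ g-ordered

-- The target digraph and the conclusion.

module _ {P : Set} {_≺_ : P → P → Set} (col : P → Fin 3) (isSPO : IsStrictPartialOrder _≡_ _≺_)
         (B : ColouredPoset) (realisation : Realisation _≺_ col B) where
  private
    module B = ColouredPoset B
  open Realisation realisation

  place-edge? : ∀ x y → Dec (Edge _≺_ col (place x) (place y))
  place-edge? x y = Twist.edge? col isSPO (map′ (cong place) place-injective (x B.≟ y))
    (Dec.map (place-≺ x y) (x B.≺? y)) (Dec.map (place-≺ y x) (y B.≺? x))

  digraph : Fin B.size → Fin B.size → Bool
  digraph i j = does (place-edge? (B.point i) (B.point j))

  digraph-edge : ∀ i j → digraph i j ≡ true ⇔ Edge _≺_ col (place (B.point i)) (place (B.point j))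
  digraph-edge i j = does-≡true (place-edge? (B.point i) (B.point j))

  digraph-inAge : InAgeP3 _≺_ col B.size digraph
  digraph-inAge = place ∘ B.point , B.point-injective ∘ place-injective , digraph-edge

expansion-property : ∀ {P : Set} {_≺_ : P → P → Set} {col : P → Fin 3} {_<_ : P → P → Set} →
  IsStrictPartialOrder _≡_ _≺_ → IsLinearExt _≺_ _<_ →
  ∀ n (E : Fin n → Fin n → Bool) (C B : ColouredPoset) →
  (∀ s → Admissible B s → ConstantCopy C B s) →
  (∀ (A : RankedPoset n) {_<_} → IsLinearExt (ColouredPoset._≺_ C) _<_ →
    Decidable _<_ → InitialEmbedding A (suc n) C _<_) →
  Realisation _≺_ col B →
  Σ ℕ λ m → Σ (Fin m → Fin m → Bool) λ E′ → InAgeP3 _≺_ col m E′ ×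
    (∀ c L → InAgeP3* _≺_ col _<_ n E c L →
     ∀ c′ L′ → InAgeP3* _≺_ col _<_ m E′ c′ L′ →
     Embeds* n E c L m E′ c′ L′)
expansion-property {col = col} isSPO lin n E C B copies C-ordering realisation =
  ColouredPoset.size B , digraph col isSPO B realisation , digraph-inAge col isSPO B realisation ,
  λ c L A* c′ L′ B* → Expansion.embeds col isSPO lin n E C B copies C-ordering
    realisation (digraph col isSPO B realisation) (digraph-edge col isSPO B realisation) A* B*

theorem9p3 : (P : Set) (_≺_ : P → P → Set) (col : P → Fin 3) (_<_ : P → P → Set) →
    IsGenericPO P _≺_ →
    (∀ c → DenseColour _≺_ col c) →
    IsLinearExt _≺_ _<_ →
    IsHomogeneousP3* _≺_ col _<_ →
    ∀ n (E : Fin n → Fin n → Bool) → InAgeP3 _≺_ col n E →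
    Σ ℕ λ m → Σ (Fin m → Fin m → Bool) λ E' → InAgeP3 _≺_ col m E' ×
    (∀ c L → InAgeP3* _≺_ col _<_ n E c L →
    ∀ c' L' → InAgeP3* _≺_ col _<_ m E' c' L' →
    Embeds* n E c L m E' c' L')
theorem9p3 P _≺_ col _<_ generic dense lin _ n E _ =
  expansion-property {col = col} (IsGenericPO.isSPO generic) lin n E C B
    (constant-copy C (basePoint (suc n))) (λ A → rich-ordering A (suc n)) (realise generic dense B)
  where
  C B : ColouredPoset
  -- One `C` serves all expansions at once, as `rich-ordering` covers every ranked poset on `n`
  -- points.
  C = rich (suc n)
  B = lex (chain 3) (double C)
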